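{- Let $\pi\colon\mathsf{States}\to\mathbb{R}_{\ge0}$ be a potential function. For every program $C$, every $X\in\mathbb{A}_\pi$ and every constant runtime $c\in\mathbb{T}$ (i.e. $c$ is a constant function $\mathsf{States}\to[0,\infty]$), $$\mathsf{aert}_\pi[\![C]\!](X+c)\;\preceq\;\mathsf{aert}_\pi[\![C]\!](X)+c .$$
   Context: States and programs. Fix a finite set $\mathrm{Vars}$ of variables; values are $\mathbb{N}$, locations are $\mathbb{N}_{>0}$. A stack is $s\colon \mathrm{Vars}\to\mathbb{N}$; a heap is a partial map $h$ from a finite set $\mathrm{dom}(h)\subseteq\mathbb{N}_{>0}$ to $\mathbb{N}$. $h_1\perp h_2$ means disjoint domains; then $h_1\star h_2$ is their union; $h_\emptyset$ is the empty heap. $\mathsf{States}$ is the set of pairs $(s,h)$. $s(e)$ is the value of a (heap-independent) arithmetic expression $e$ under $s$, $s\models\varphi$ means the Boolean expression $\varphi$ holds under $s$, $s[x\mapsto v]$ is the updated stack. Programs are generated by $C ::= \mathtt{tick}(e) \mid x:=e \mid x:=\mathtt{alloc}(e) \mid \langle e\rangle:=e' \mid x:=\langle e\rangle \mid \mathtt{free}(e) \mid \{C\}[p]\{C\} \mid \mathtt{if}(\varphi)\{C\}\mathtt{else}\{C\} \mid C;C \mid \mathtt{while}(\varphi)\{C\}$, where $p$ is an expression with $s(p)\in[0,1]\cap\mathbb{Q}$ for all $s$. The statements other than tick, probabilistic choice, conditional, sequencing and loops are called atomic. Runtimes. $\mathbb{T}$ is the set of functions $\mathsf{States}\to[0,\infty]$,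 ordered pointwise by $\preceq$; arithmetic is pointwise with $0\cdot\infty=0$. $[\varphi]$ is the $0/1$-valued Iverson bracket. Truncated subtraction: $a\dot- b=\max(a-b,0)$, $\infty\dot- b=\infty$ for finite $b$, $a\dot-\infty=0$. $(f\oplus g)(s,h)=\min\{f(s,h_1)+g(s,h_2)\mid h=h_1\star h_2\}$; $(f \mathbin{ -\!\!\ominus} g)(s,h)=\sup\{g(s,h\star h')\dot- f(s,h')\mid h'\perp h\}$; $(\inf y\colon f)(s,h)=\inf_{v\in\mathbb{N}} f(s[y\mapsto v],h)$, $(\sup y\colon f)(s,h)=\sup_{v\in\mathbb{N}}f(s[y\mapsto v],h)$; $f[x/e](s,h)=f(s[x\mapsto s(e)],h)$. $\mathsf{tm}(e)(s,h)=s(e)$ if $h=h_\emptyset$, else $\infty$; $[e\mapsto e'](s,h)=0$ if $\mathrm{dom}(h)=\{s(e)\}$ and $h(s(e))=s(e')$, else $\infty$; $[e\mapsto -](s,h)=0$ if $\mathrm{dom}(h)=\{s(e)\}$, else $\infty$; $\bigoplus_{i=1}^{e} f_i$ is the separating sum over $i=1,\dots,s(e)$ (empty one: $[\mathsf{emp}]$, which is $0$ if $h=h_\emptyset$, else $\infty$). $\mathsf{ert}[\![C]\!]\colon\mathbb{T}\to\mathbb{T}$ (with $v$ fresh): $\mathsf{ert}[\![\mathtt{tick}(e)]\!](f)=\mathsf{tm}(e)\oplus f$; $\mathsf{ert}[\![x:=e]\!](f)=f[x/e]$; $\mathsf{ert}[\![x:=\mathtt{alloc}(e)]\!](f)=\sup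 v\colon (\bigoplus_{i=1}^{e}[v+i-1\mapsto 0])\mathbin{ -\!\!\ominus} f[x/v]$; $\mathsf{ert}[\![\langle e\rangle:=e']\!](f)=[e\mapsto-]\oplus([e\mapsto e']\mathbin{ -\!\!\ominus} f)$; $\mathsf{ert}[\![x:=\langle e\rangle]\!](f)=\inf v\colon [e\mapsto v]\oplus([e\mapsto v]\mathbin{ -\!\!\ominus} f[x/v])$; $\mathsf{ert}[\![\mathtt{free}(e)]\!](f)=[e\mapsto-]\oplus f$; $\mathsf{ert}[\![C_1;C_2]\!](f)=\mathsf{ert}[\![C_1]\!](\mathsf{ert}[\![C_2]\!](f))$; conditional: $[\varphi]\cdot\mathsf{ert}[\![C_1]\!](f)+[\neg\varphi]\cdot\mathsf{ert}[\![C_2]\!](f)$; probabilistic choice: $p\cdot\mathsf{ert}[\![C_1]\!](f)+(1-p)\cdot\mathsf{ert}[\![C_2]\!](f)$; $\mathsf{ert}[\![\mathtt{while}(\varphi)\{C\}]\!](f)=\mathrm{lfp}\, g.\ [\neg\varphi]\cdot f+[\varphi]\cdot\mathsf{ert}[\![C]\!](g)$. Amortized runtimes. A potential function is $\pi\colon\mathsf{States}\to\mathbb{R}_{\ge0}$. $\mathbb{A}_\pi=\{X\colon\mathsf{States}\to\mathbb{R}\cup\{\infty\}\mid -\pi\le X\}$, ordered pointwise (complete lattice, least element $-\pi$). $\mathsf{aert}_\pi[\![C]\!]\colon\mathbb{A}_\pi\to\mathbb{A}_\pi$: $\mathsf{aert}_\pi[\![\mathtt{tick}(e)]\!](X)=e+X$;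 for atomic $C$ other than tick, $\mathsf{aert}_\pi[\![C]\!](X)=\mathsf{ert}[\![C]\!](X+\pi)-\pi$; sequencing by composition; conditional $[\varphi]\cdot\mathsf{aert}_\pi[\![C_1]\!](X)+[\neg\varphi]\cdot\mathsf{aert}_\pi[\![C_2]\!](X)$; probabilistic choice $p\cdot\mathsf{aert}_\pi[\![C_1]\!](X)+(1-p)\cdot\mathsf{aert}_\pi[\![C_2]\!](X)$; $\mathsf{aert}_\pi[\![\mathtt{while}(\varphi)\{C'\}]\!](X)=\mathrm{lfp}\,Y.\ [\neg\varphi]\cdot X+[\varphi]\cdot\mathsf{aert}_\pi[\![C']\!](Y)$ in $(\mathbb{A}_\pi,\preceq)$. -}

module Defs where

open import Level using (0ℓ)
open import Axiom.ExcludedMiddle using (ExcludedMiddle)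
open import Algebra.Bundles using (CommutativeRing)
import Algebra.Construct.NaturalChoice.Max as Max
import Algebra.Definitions.RawMonoid as RawMonoidDefs
import Algebra.Properties.Ring as RingProperties
open import Data.Bool.Base using (Bool; true; false; not; if_then_else_)
open import Data.Fin.Base using (Fin)
open import Data.Integer.Base as ℤ using (ℤ; +_; -[1+_])
import Data.Integer.Properties as ℤ
open import Data.List.Base using (List; []; _∷_; map)
open import Data.List.Membership.Propositional using (_∈_)
open import Data.List.Relation.Unary.Linked using (Linked; [-])
open import Data.Nat.Base as ℕ using (ℕ; zero; suc; z≤n; s≤s)
open import Data.Product.Base using (Σ; Σ-syntax; ∃; ∃-syntax; _×_; _,_; proj₁; proj₂)
open import Data.Rational.Base as ℚ using (ℚ; mkℚ; 0ℚ; 1ℚ)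
open import Data.Sum.Base using (_⊎_; inj₁; inj₂)
open import Data.Vec.Base using (Vec; lookup; _[_]≔_)
open import Function.Bundles using (_⇔_)
open import Relation.Binary.Bundles using (TotalOrder)
open import Relation.Binary.Core using (Rel)
open import Relation.Binary.PropositionalEquality.Core as ≡ using (_≡_; refl)
import Relation.Binary.Construct.Add.Supremum.Equality as AddSupEquality
import Relation.Binary.Construct.Add.Supremum.NonStrict as AddSupOrder
open import Relation.Binary.Structures using (IsTotalOrder)
open import Relation.Nullary using (¬_; Dec; yes; no; contradiction)
open import Relation.Nullary.Construct.Add.Supremum using (_⁺; ⊤⁺; [_])

module Bounds {A : Set} (_≤_ : Rel A 0ℓ) {I : Set} (f : I → A) where

  UpperBound LowerBound : A → Set
  UpperBound u = ∀ i → f i ≤ u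
  LowerBound l = ∀ i → l ≤ f i

  IsSup IsInf : A → Set
  IsSup u = UpperBound u × (∀ v → UpperBound v → u ≤ v)
  IsInf l = LowerBound l × (∀ k → LowerBound k → k ≤ l)

-- The real numbers: ℝ is, up to unique isomorphism, the only Dedekind
-- complete ordered field.  The equality of the carrier is a setoid
-- equality.
record CompleteOrderedField : Set₁ where
  infix 4 _≤_
  field
    commutativeRing : CommutativeRing 0ℓ 0ℓ
  open CommutativeRing commutativeRing public
    renaming (Carrier to ℝ; refl to ≈-refl; sym to ≈-sym; trans to ≈-trans)
  field
    _≤_          : Rel ℝ 0ℓ
    isTotalOrder : IsTotalOrder _≈_ _≤_
    +-monoˡ-≤    : ∀ {x y} z → x ≤ y → x + z ≤ y + z
    *-nonNeg     : ∀ {x y} → 0# ≤ x → 0# ≤ y → 0# ≤ x * y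
    0≉1          : ¬ 0# ≈ 1#
    inverse      : ∀ {x} → ¬ x ≈ 0# → ∃[ y ] x * y ≈ 1#
    supremum     : {I : Set} (f : I → ℝ) → I →
                   ∃ (Bounds.UpperBound _≤_ f) → ∃ (Bounds.IsSup _≤_ f)

module RealProperties (𝓡 : CompleteOrderedField) where

  open CompleteOrderedField 𝓡 public
  open RingProperties ring using (-‿distribˡ-*; -‿distribʳ-*; -‿involutive; -0#≈0#)
  open RawMonoidDefs +-rawMonoid using () renaming (_×_ to _·ℕ_)

  totalOrder : TotalOrder 0ℓ 0ℓ 0ℓ
  totalOrder = record { isTotalOrder = isTotalOrder }

  open TotalOrder totalOrder public
    using (total; antisym; poset; ≤-resp-≈)
    renaming (refl to ≤-refl; reflexive to ≤-reflexive; trans to ≤-trans)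
  open Max totalOrder public using (_⊔_)
  open import Algebra.Construct.NaturalChoice.MaxOp (Max.maxOperator totalOrder) public
    using (x≤x⊔y; x≤y⊔x)

  +-mono-≤ : ∀ {w x y z} → w ≤ x → y ≤ z → w + y ≤ x + z
  +-mono-≤ {w} {x} {y} {z} w≤x y≤z = ≤-trans (+-monoˡ-≤ y w≤x)
    (≤-trans (≤-reflexive (+-comm x y))
      (≤-trans (+-monoˡ-≤ x y≤z) (≤-reflexive (+-comm z x))))

  x≤y⇒0≤y-x : ∀ {x y} → x ≤ y → 0# ≤ y + - x
  x≤y⇒0≤y-x {x} x≤y = ≤-trans (≤-reflexive (≈-sym (-‿inverseʳ x))) (+-monoˡ-≤ (- x) x≤y)

  0≤y-x⇒x≤y : ∀ {x y} → 0# ≤ y + - x → x ≤ y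
  0≤y-x⇒x≤y {x} {y} p = ≤-trans (≤-reflexive (≈-sym (+-identityˡ x)))
    (≤-trans (+-monoˡ-≤ x p) (≤-reflexive
      (≈-trans (+-assoc y (- x) x) (≈-trans (+-congˡ (-‿inverseˡ x)) (+-identityʳ y)))))

  *-monoˡ-≤ : ∀ {a x y} → 0# ≤ a → x ≤ y → a * x ≤ a * y
  *-monoˡ-≤ {a} {x} {y} 0≤a x≤y = 0≤y-x⇒x≤y (≤-trans (*-nonNeg 0≤a (x≤y⇒0≤y-x x≤y))
    (≤-reflexive (≈-trans (distribˡ a y (- x)) (+-congˡ (≈-sym (-‿distribʳ-* a x))))))

  x≤0⇒0≤-x : ∀ {x} → x ≤ 0# → 0# ≤ - x
  x≤0⇒0≤-x x≤0 = ≤-trans (x≤y⇒0≤y-x x≤0) (≤-reflexive (+-identityˡ _))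

  0≤1 : 0# ≤ 1#
  0≤1 with total 0# 1#
  ... | inj₁ p = p
  ... | inj₂ 1≤0 = ≤-trans (*-nonNeg (x≤0⇒0≤-x 1≤0) (x≤0⇒0≤-x 1≤0)) (≤-reflexive
    (≈-trans (≈-sym (-‿distribˡ-* 1# (- 1#)))
      (≈-trans (-‿cong (*-identityˡ (- 1#))) (-‿involutive 1#))))

  1≰0 : ¬ 1# ≤ 0#
  1≰0 1≤0 = 0≉1 (antisym 0≤1 1≤0)

  fromℕ : ℕ → ℝ
  fromℕ n = n ·ℕ 1#

  fromℕ-mono : ∀ {m n} → m ℕ.≤ n → fromℕ m ≤ fromℕ n
  fromℕ-mono {n = zero}  z≤n = ≤-refl
  fromℕ-mono {n = suc n} z≤n =
    ≤-trans (≤-reflexive (≈-sym (+-identityˡ 0#))) (+-mono-≤ 0≤1 (fromℕ-mono {0} {n} z≤n))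
  fromℕ-mono (s≤s m≤n) = +-mono-≤ ≤-refl (fromℕ-mono m≤n)

  0≤fromℕ : ∀ n → 0# ≤ fromℕ n
  0≤fromℕ n = fromℕ-mono {0} {n} z≤n

  fromℕ-suc≉0 : ∀ n → ¬ fromℕ (suc n) ≈ 0#
  fromℕ-suc≉0 n eq = 1≰0 (≤-trans (≤-reflexive (≈-sym (+-identityʳ 1#)))
    (≤-trans (+-mono-≤ ≤-refl (0≤fromℕ n)) (≤-reflexive eq)))

  inverse-nonNeg : ∀ {x y} → 0# ≤ x → x * y ≈ 1# → 0# ≤ y
  inverse-nonNeg {x} {y} 0≤x xy≈1 with total 0# y
  ... | inj₁ p = p
  ... | inj₂ y≤0 = contradiction
    (≤-trans (≤-reflexive (≈-sym xy≈1)) (≤-trans (*-monoˡ-≤ 0≤x y≤0) (≤-reflexive (zeroʳ x))))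
    1≰0

  fromℤ : ℤ → ℝ
  fromℤ (+ n)    = fromℕ n
  fromℤ -[1+ n ] = - fromℕ (suc n)

  fromℚ : ℚ → ℝ
  fromℚ q = fromℤ (ℚ.numerator q) * proj₁ (inverse (fromℕ-suc≉0 (ℚ.denominator-1 q)))

  0≤fromℚ : ∀ {q} → 0ℚ ℚ.≤ q → 0# ≤ fromℚ q
  0≤fromℚ {mkℚ (+ n) d _} _ =
    *-nonNeg (0≤fromℕ n) (inverse-nonNeg (0≤fromℕ (suc d)) (proj₂ (inverse (fromℕ-suc≉0 d))))
  0≤fromℚ {mkℚ -[1+ n ] d _} (ℚ.*≤* ())

  fromℚ≤1 : ∀ {q} → 0ℚ ℚ.≤ q → q ℚ.≤ 1ℚ → fromℚ q ≤ 1#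
  fromℚ≤1 {mkℚ -[1+ n ] d _} (ℚ.*≤* ()) _
  fromℚ≤1 {mkℚ (+ n) d _} _ (ℚ.*≤* n≤d) with inverse (fromℕ-suc≉0 d)
  ... | r , dr≈1 = ≤-trans (≤-reflexive (*-comm (fromℕ n) r))
    (≤-trans (*-monoˡ-≤ (inverse-nonNeg (0≤fromℕ (suc d)) dr≈1) (fromℕ-mono n≤1+d))
      (≤-reflexive (≈-trans (*-comm r (fromℕ (suc d))) dr≈1)))
    where
    n≤1+d : n ℕ.≤ suc d
    n≤1+d = ℤ.drop‿+≤+
      (≡.subst₂ ℤ._≤_ (ℤ.*-identityʳ (+ n)) (ℤ.*-identityˡ (+ suc d)) n≤d)

module Extended (𝓡 : CompleteOrderedField) (em : ExcludedMiddle 0ℓ) where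

  open RealProperties 𝓡 public
  open AddSupEquality _≈_ public using (_≈⁺_; ⊤⁺≈⊤⁺; [_])
  open AddSupOrder _≤_ public using (_≤⁺_; _≤⊤⁺; [_])

  ℝ∞ : Set
  ℝ∞ = ℝ ⁺

  ∞ : ℝ∞
  ∞ = ⊤⁺

  ≤⁺-trans : ∀ {x y z} → x ≤⁺ y → y ≤⁺ z → x ≤⁺ z
  ≤⁺-trans = AddSupOrder.≤⁺-trans _≤_ ≤-trans

  infixl 6 _+∞_
  infixl 7 _·∞_
  infixl 6 _∸∞_

  _+∞_ : ℝ∞ → ℝ∞ → ℝ∞
  [ x ] +∞ [ y ] = [ x + y ]
  [ x ] +∞ ⊤⁺    = ∞
  ⊤⁺    +∞ y     = ∞

  -- Only used for 0 ≤ a.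
  _·∞_ : ℝ → ℝ∞ → ℝ∞
  a ·∞ [ x ] = [ a * x ]
  a ·∞ ⊤⁺ with em {a ≈ 0#}
  ... | yes _ = [ 0# ]
  ... | no  _ = ∞

  -- Truncated subtraction; in particular ∞ ∸∞ ∞ is 0.
  _∸∞_ : ℝ∞ → ℝ∞ → ℝ∞
  x     ∸∞ ⊤⁺    = [ 0# ]
  ⊤⁺    ∸∞ [ y ] = ∞
  [ x ] ∸∞ [ y ] = [ (x + - y) ⊔ 0# ]

  +∞-mono-≤ : ∀ {w x y z} → w ≤⁺ x → y ≤⁺ z → (w +∞ y) ≤⁺ (x +∞ z)
  +∞-mono-≤ [ p ]    [ q ]    = [ +-mono-≤ p q ]
  +∞-mono-≤ [ p ]    (_ ≤⊤⁺)  = _ ≤⊤⁺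
  +∞-mono-≤ (_ ≤⊤⁺)  _        = _ ≤⊤⁺

  record [_,∞] (b : ℝ) : Set where
    constructor _,_
    field
      value : ℝ∞
      bound : [ b ] ≤⁺ value

  open [_,∞] public

  infix 4 _⊑_ _≃_
  _⊑_ _≃_ : ∀ {b} → Rel [ b ,∞] 0ℓ
  x ⊑ y = value x ≤⁺ value y
  x ≃ y = value x ≈⁺ value y

  top : ∀ {b} → [ b ,∞]
  top = ∞ , (_ ≤⊤⁺)

  module _ {b : ℝ} {I : Set} where

    infimum : (f : I → [ b ,∞]) → ∃ (Bounds.IsInf _⊑_ f)
    infimum f with em {∃[ i ] ∃[ r ] value (f i) ≡ [ r ]}
    ... | no ∄fin = top , (λ i → lower i (value (f i)) refl) , (λ _ _ → _ ≤⊤⁺)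
      where
      lower : ∀ i x → value (f i) ≡ x → ∞ ≤⁺ x
      lower i [ r ] eq = contradiction (i , r , eq) ∄fin
      lower i ⊤⁺    eq = _ ≤⊤⁺
    ... | yes (i₀ , r₀ , eq₀) = ([ m ] , [ proj₁ m-sup (b , (λ i → bound (f i))) ])
                              , (λ i → lower i (value (f i)) refl) , greatest
      where
      L : Set
      L = Σ[ r ∈ ℝ ] (∀ i → [ r ] ≤⁺ value (f i))

      finiteBelow : ∀ {x r s} → x ≡ [ r ] → [ s ] ≤⁺ x → s ≤ r
      finiteBelow refl [ p ] = p

      sup : ∃ (Bounds.IsSup _≤_ {L} proj₁)
      sup = supremum proj₁ (b , (λ i → bound (f i))) (r₀ , λ (_ , lb) → finiteBelow eq₀ (lb i₀))
      m = proj₁ sup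
      m-sup = proj₂ sup

      lower : ∀ i x → value (f i) ≡ x → [ m ] ≤⁺ x
      lower i [ r ] eq = [ proj₂ m-sup r (λ (_ , lb) → finiteBelow eq (lb i)) ]
      lower i ⊤⁺    eq = _ ≤⊤⁺

      infinite : ∀ {x} → x ≡ [ r₀ ] → ¬ (∞ ≤⁺ x)
      infinite refl ()

      greatest : ∀ k → (∀ i → value k ≤⁺ value (f i)) → value k ≤⁺ [ m ]
      greatest ([ r ] , _) lb = [ proj₁ m-sup (r , lb) ]
      greatest (⊤⁺    , _) lb = contradiction (lb i₀) (infinite eq₀)

    ⨅ : (I → [ b ,∞]) → [ b ,∞]
    ⨅ f = proj₁ (infimum f)

  supremum∞ : ∀ {b} {I : Set} (f : I → [ b ,∞]) → ∃ (Bounds.IsSup _⊑_ f)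
  supremum∞ f with infimum {I = ∃ (Bounds.UpperBound _⊑_ f)} proj₁
  ... | u , u-lower , u-greatest =
    u , (λ i → u-greatest (f i) (λ (_ , ub) → ub i)) , (λ v ub → u-lower (v , ub))

  ⨆ : ∀ {b} {I : Set} → (I → [ b ,∞]) → [ b ,∞]
  ⨆ f = proj₁ (supremum∞ f)

  infixl 6 _⊹_ _⊖_

  _⊹_ : ∀ {b} → [ b ,∞] → [ 0# ,∞] → [ b ,∞]
  value (x ⊹ c) = value x +∞ value c
  bound (_⊹_ {b} x c) = ≤⁺-trans [ ≤-reflexive (≈-sym (+-identityʳ b)) ]
    (+∞-mono-≤ (bound x) (bound c))

  _⊖_ : [ 0# ,∞] → [ 0# ,∞] → [ 0# ,∞]
  x ⊖ y = value x ∸∞ value y , nonNeg (value x) (value y)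
    where
    nonNeg : ∀ x y → [ 0# ] ≤⁺ (x ∸∞ y)
    nonNeg x     ⊤⁺    = [ ≤-refl ]
    nonNeg ⊤⁺    [ y ] = _ ≤⊤⁺
    nonNeg [ x ] [ y ] = [ x≤y⊔x (x + - y) 0# ]

  addReal : ∀ {r} → [ - r ,∞] → [ 0# ,∞]
  value (addReal {r} x) = value x +∞ [ r ]
  bound (addReal {r} x) = ≤⁺-trans [ ≤-reflexive (≈-sym (-‿inverseˡ r)) ]
    (+∞-mono-≤ (bound x) [ ≤-refl ])

  subtractReal : ∀ {r} → [ 0# ,∞] → [ - r ,∞]
  value (subtractReal {r} x) = value x +∞ [ - r ]
  bound (subtractReal {r} x) = ≤⁺-trans [ ≤-reflexive (≈-sym (+-identityˡ (- r))) ]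
    (+∞-mono-≤ (bound x) [ ≤-refl ])

  natural : ℕ → [ 0# ,∞]
  natural n = [ fromℕ n ] , [ 0≤fromℕ n ]

  zeroIf : Set → [ 0# ,∞]
  zeroIf P with em {P}
  ... | yes _ = [ 0# ] , [ ≤-refl ]
  ... | no  _ = top

  record Weights : Set where
    field
      w₁ w₂   : ℝ
      0≤w₁    : 0# ≤ w₁
      0≤w₂    : 0# ≤ w₂
      w₁+w₂≈1 : w₁ + w₂ ≈ 1#

  weighted : ∀ {b} → Weights → [ b ,∞] → [ b ,∞] → [ b ,∞]
  weighted {b} W x y = w₁ ·∞ value x +∞ w₂ ·∞ value y ,
    ≤⁺-trans [ ≤-reflexive b≈ ]
      (+∞-mono-≤ (scaled 0≤w₁ (value x) (bound x)) (scaled 0≤w₂ (value y) (bound y)))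
    where
    open Weights W

    b≈ : b ≈ w₁ * b + w₂ * b
    b≈ = ≈-trans (≈-sym (*-identityˡ b))
      (≈-trans (*-congʳ (≈-sym w₁+w₂≈1)) (distribʳ b w₁ w₂))

    scaled : ∀ {a} → 0# ≤ a → ∀ x → [ b ] ≤⁺ x → [ a * b ] ≤⁺ a ·∞ x
    scaled 0≤a [ x ] [ p ] = [ *-monoˡ-≤ 0≤a p ]
    scaled {a} 0≤a ⊤⁺ _ with em {a ≈ 0#}
    ... | yes a≈0 = [ ≤-reflexive (≈-trans (*-congʳ a≈0) (zeroˡ b)) ]
    ... | no  _   = _ ≤⊤⁺

  iverson : Bool → ℝ
  iverson φ = if φ then 1# else 0#

  guard : Bool → Weights
  guard φ = record
    { w₁ = iverson φ ; w₂ = iverson (not φ)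
    ; 0≤w₁ = nonNeg φ ; 0≤w₂ = nonNeg (not φ) ; w₁+w₂≈1 = sum φ }
    where
    nonNeg : ∀ φ → 0# ≤ iverson φ
    nonNeg true  = 0≤1
    nonNeg false = ≤-refl
    sum : ∀ φ → iverson φ + iverson (not φ) ≈ 1#
    sum true  = +-identityʳ 1#
    sum false = +-identityˡ 1#

  bias : (Σ[ p ∈ ℚ ] 0ℚ ℚ.≤ p × p ℚ.≤ 1ℚ) → Weights
  bias (p , 0≤p , p≤1) = record
    { w₁ = fromℚ p ; w₂ = 1# + - fromℚ p
    ; 0≤w₁ = 0≤fromℚ 0≤p ; 0≤w₂ = x≤y⇒0≤y-x (fromℚ≤1 0≤p p≤1)
    ; w₁+w₂≈1 = ≈-trans (+-comm (fromℚ p) _)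
        (≈-trans (+-assoc 1# _ _) (≈-trans (+-congˡ (-‿inverseˡ (fromℚ p))) (+-identityʳ 1#))) }

-- A finite partial map is represented by its graph, listed by strictly
-- increasing location.  Starting the chain at 0 makes all locations
-- positive.  The representation is canonical: _≡_ on heaps is equality
-- of partial maps.
record Heap : Set where
  constructor heap
  field
    graph       : List (ℕ × ℕ)
    .increasing : Linked ℕ._<_ (0 ∷ map proj₁ graph)

∅ : Heap
∅ = heap [] [-]

infix 4 _↦_∈ʰ_ _∈dom_ _⊥_ _≡_⋆_

_↦_∈ʰ_ : ℕ → ℕ → Heap → Set
l ↦ v ∈ʰ h = (l , v) ∈ Heap.graph h

_∈dom_ : ℕ → Heap → Set
l ∈dom h = ∃[ v ] l ↦ v ∈ʰ h

_⊥_ : Heap → Heap → Set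
h₁ ⊥ h₂ = ∀ l → l ∈dom h₁ → ¬ l ∈dom h₂

_≡_⋆_ : Heap → Heap → Heap → Set
h ≡ h₁ ⋆ h₂ = h₁ ⊥ h₂ × (∀ l v → l ↦ v ∈ʰ h ⇔ (l ↦ v ∈ʰ h₁ ⊎ l ↦ v ∈ʰ h₂))

Dom≡⁅_⁆ : ℕ → Heap → Set
Dom≡⁅ l ⁆ h = ∀ k → k ∈dom h ⇔ k ≡ l

module Programs (n : ℕ) where

  Var : Set
  Var = Fin n

  Stack : Set
  Stack = Vec ℕ n

  State : Set
  State = Stack × Heap

  -- Expressions are identified with their semantics s ↦ s(e).
  Expr BoolExpr ProbExpr : Set
  Expr     = Stack → ℕ
  BoolExpr = Stack → Bool
  ProbExpr = Stack → Σ[ p ∈ ℚ ] 0ℚ ℚ.≤ p × p ℚ.≤ 1ℚ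

  data Atomic : Set where
    _≔_       : Var → Expr → Atomic
    _≔alloc_  : Var → Expr → Atomic
    ⟨_⟩≔_     : Expr → Expr → Atomic
    _≔⟨_⟩     : Var → Expr → Atomic
    free      : Expr → Atomic

  infixr 5 _⨾_

  data Program : Set where
    tick          : Expr → Program
    atomic        : Atomic → Program
    ⟪_⟫[_]⟪_⟫     : Program → ProbExpr → Program → Program
    If_then_else_ : BoolExpr → Program → Program → Program
    _⨾_           : Program → Program → Program
    while         : BoolExpr → Program → Program

module Calculus (𝓡 : CompleteOrderedField) (em : ExcludedMiddle 0ℓ) (n : ℕ) where

  open Extended 𝓡 em public
  open Programs n public

  -- The functions X : State → ℝ ∪ {∞} with b ≼ X.
  Above : (State → ℝ) → Set
  Above b = (σ : State) → [ b σ ,∞]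

  infix 4 _≼_
  _≼_ : ∀ {b} → Rel (Above b) 0ℓ
  X ≼ Y = ∀ σ → X σ ⊑ Y σ

  𝕋 : Set
  𝕋 = Above (λ _ → 0#)

  𝔸 : (State → ℝ) → Set
  𝔸 π = Above (λ σ → - π σ)

  -- The infimum of all fixed points; when there is a least one, this
  -- is it.
  lfp : ∀ {b} → (Above b → Above b) → Above b
  lfp {b} Φ σ = ⨅ {I = Σ[ Y ∈ Above b ] (∀ τ → Φ Y τ ≃ Y τ)} (λ (Y , _) → Y σ)

  infixl 6 _∔_
  _∔_ : ∀ {b} → Above b → 𝕋 → Above b
  (X ∔ f) σ = X σ ⊹ f σ

  cond : ∀ {b} → BoolExpr → Above b → Above b → Above b
  cond φ X Y (s , h) = weighted (guard (φ s)) (X (s , h)) (Y (s , h))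

  mix : ∀ {b} → ProbExpr → Above b → Above b → Above b
  mix p X Y (s , h) = weighted (bias (p s)) (X (s , h)) (Y (s , h))

  infixr 5 _⊕_ _─⊖_

  _⊕_ : 𝕋 → 𝕋 → 𝕋
  (f ⊕ g) (s , h) =
    ⨅ {I = Σ[ h₁ ∈ Heap ] Σ[ h₂ ∈ Heap ] h ≡ h₁ ⋆ h₂}
      (λ (h₁ , h₂ , _) → f (s , h₁) ⊹ g (s , h₂))

  -- h″ is h ⋆ h′.
  _─⊖_ : 𝕋 → 𝕋 → 𝕋
  (f ─⊖ g) (s , h) =
    ⨆ {I = Σ[ h′ ∈ Heap ] Σ[ h″ ∈ Heap ] h″ ≡ h ⋆ h′}
      (λ (h′ , h″ , _) → g (s , h″) ⊖ f (s , h′))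

  -- The quantified variable is fresh, so it is bound in Agda instead
  -- of being stored in the stack.
  Inf Sup : (ℕ → 𝕋) → 𝕋
  Inf f σ = ⨅ (λ v → f v σ)
  Sup f σ = ⨆ (λ v → f v σ)

  val : ℕ → Expr
  val v _ = v

  _[_/_] : 𝕋 → Var → Expr → 𝕋
  (f [ x / e ]) (s , h) = f (s [ x ]≔ e s , h)

  emp : 𝕋
  emp (s , h) = zeroIf (h ≡ ∅)

  tm : Expr → 𝕋
  tm e (s , h) = natural (e s) ⊹ zeroIf (h ≡ ∅)

  _⟼_ : Expr → Expr → 𝕋
  (e ⟼ e′) (s , h) = zeroIf (Dom≡⁅ e s ⁆ h × e s ↦ e′ s ∈ʰ h)

  _⟼- : Expr → 𝕋
  (e ⟼-) (s , h) = zeroIf (Dom≡⁅ e s ⁆ h)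

  -- ⨁ k f is f 1 ⊕ … ⊕ f k.
  ⨁ : ℕ → (ℕ → 𝕋) → 𝕋
  ⨁ zero    f = emp
  ⨁ (suc k) f = ⨁ k f ⊕ f (suc k)

  -- The zero cells v, …, v + e - 1.
  block : Expr → ℕ → 𝕋
  block e v (s , h) = ⨁ (e s) (λ i → val (v ℕ.+ i ℕ.∸ 1) ⟼ val 0) (s , h)

  ertᵃ : Atomic → 𝕋 → 𝕋
  ertᵃ (x ≔ e)       f = f [ x / e ]
  ertᵃ (x ≔alloc e)  f = Sup λ v → block e v ─⊖ f [ x / val v ]
  ertᵃ (⟨ e ⟩≔ e′)   f = (e ⟼-) ⊕ ((e ⟼ e′) ─⊖ f)
  ertᵃ (x ≔⟨ e ⟩)    f = Inf λ v → (e ⟼ val v) ⊕ ((e ⟼ val v) ─⊖ f [ x / val v ])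
  ertᵃ (free e)      f = (e ⟼-) ⊕ f

  ert : Program → 𝕋 → 𝕋
  ert (tick e)              f = tm e ⊕ f
  ert (atomic A)            f = ertᵃ A f
  ert (⟪ C₁ ⟫[ p ]⟪ C₂ ⟫)   f = mix p (ert C₁ f) (ert C₂ f)
  ert (If φ then C₁ else C₂)  f = cond φ (ert C₁ f) (ert C₂ f)
  ert (C₁ ⨾ C₂)             f = ert C₁ (ert C₂ f)
  ert (while φ C)           f = lfp λ g → cond φ (ert C g) f

  module _ {π : State → ℝ} where

    _+π : 𝔸 π → 𝕋
    (X +π) σ = addReal (X σ)

    _-π : 𝕋 → 𝔸 π
    (f -π) σ = subtractReal (f σ)

  aert : (π : State → ℝ) → Program → 𝔸 π → 𝔸 π
  aert π (tick e)              X = X ∔ λ (s , _) → natural (e s)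
  aert π (atomic A)            X = ert (atomic A) (X +π) -π
  aert π (⟪ C₁ ⟫[ p ]⟪ C₂ ⟫)   X = mix p (aert π C₁ X) (aert π C₂ X)
  aert π (If φ then C₁ else C₂)  X = cond φ (aert π C₁ X) (aert π C₂ X)
  aert π (C₁ ⨾ C₂)             X = aert π C₁ (aert π C₂ X)
  aert π (while φ C)           X = lfp λ Y → cond φ (aert π C Y) X

{-# OPTIONS --safe #-}
-- The key is to prove by induction on C the formally stronger claim that
-- X ≼ Y + r implies aert π C X ≼ aert π C Y + r for every real r ≥ 0.  Its case
-- r = 0 is monotonicity, so a single induction yields both the existence of
-- the least fixed points of loops and the theorem: if L is the least fixed
-- point for the postexpectation Y, then L + r is a prefixed point for X.
module Submission where

open import Defs
open import Level using (0ℓ)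
open import Axiom.ExcludedMiddle using (ExcludedMiddle)
import Algebra.Construct.NaturalChoice.MaxOp as MaxOpProperties
open import Algebra.Construct.NaturalChoice.Max using (maxOperator)
import Algebra.Properties.CommutativeSemigroup as CommutativeSemigroupProperties
open import Data.Nat.Base using (ℕ)
open import Data.Product.Base using (Σ-syntax; _,_; proj₁; proj₂)
open import Data.Sum.Base using (inj₁; inj₂)
open import Data.Vec.Base using (_[_]≔_)
import Relation.Binary.Construct.Add.Supremum.NonStrict as AddSupOrder
open import Relation.Binary.PropositionalEquality.Core as ≡ using ()
open import Relation.Nullary using (contradiction; yes; no)
open import Relation.Nullary.Construct.Add.Supremum using (⊤⁺; [_])

-- Arithmetic of extended reals up to a real slack.

module ExtendedProperties (𝓡 : CompleteOrderedField) (em : ExcludedMiddle 0ℓ) where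

  open Extended 𝓡 em
  open CommutativeSemigroupProperties +-commutativeSemigroup using (interchange; xy∙z≈xz∙y)
  open MaxOpProperties (maxOperator totalOrder) using (⊔-lub)

  ≤⁺-refl : ∀ {x} → x ≤⁺ x
  ≤⁺-refl = AddSupOrder.≤⁺-reflexive-≡ _≤_ (λ { ≡.refl → ≤-refl }) ≡.refl

  ≤⁺-antisym : ∀ {x y} → x ≤⁺ y → y ≤⁺ x → x ≈⁺ y
  ≤⁺-antisym = AddSupOrder.≤⁺-antisym _≤_ antisym

  ≤+∞∞ : ∀ {x} y → x ≤⁺ y +∞ ∞
  ≤+∞∞ [ _ ] = _ ≤⊤⁺
  ≤+∞∞ ⊤⁺    = _ ≤⊤⁺

  infix 4 _≤[_]_
  -- The slack is a finite real, so that it can be moved to the other side by subtraction.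
  _≤[_]_ : ℝ∞ → ℝ → ℝ∞ → Set
  x ≤[ r ] y = x ≤⁺ y +∞ [ r ]

  x+r-r≈x : ∀ x r → (x + r) + - r ≈ x
  x+r-r≈x x r = ≈-trans (+-assoc x r (- r)) (≈-trans (+-congˡ (-‿inverseʳ r)) (+-identityʳ x))

  x-r+r≈x : ∀ x r → (x + - r) + r ≈ x
  x-r+r≈x x r = ≈-trans (+-assoc x (- r) r) (≈-trans (+-congˡ (-‿inverseˡ r)) (+-identityʳ x))

  ≤[]⇒-r≤ : ∀ {r x y} → x ≤[ r ] y → x +∞ [ - r ] ≤⁺ y
  ≤[]⇒-r≤ {r} {[ x ]} {[ y ]} [ p ] =
    [ ≤-trans (+-monoˡ-≤ (- r) p) (≤-reflexive (x+r-r≈x y r)) ]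
  ≤[]⇒-r≤ {y = ⊤⁺} _ = _ ≤⊤⁺

  -r≤⇒≤[] : ∀ {r x y} → x +∞ [ - r ] ≤⁺ y → x ≤[ r ] y
  -r≤⇒≤[] {r} {[ x ]} {[ y ]} [ p ] =
    [ ≤-trans (≤-reflexive (≈-sym (x-r+r≈x x r))) (+-monoˡ-≤ r p) ]
  -r≤⇒≤[] {y = ⊤⁺} _ = _ ≤⊤⁺

  x≤x+r : ∀ {x r} → 0# ≤ r → x ≤ x + r
  x≤x+r {x} 0≤r = ≤-trans (≤-reflexive (≈-sym (+-identityʳ x))) (+-mono-≤ ≤-refl 0≤r)

  ≤⁺⇒≤[] : ∀ {r x y} → 0# ≤ r → x ≤⁺ y → x ≤[ r ] y
  ≤⁺⇒≤[] {y = [ y ]} 0≤r [ p ] = [ ≤-trans p (x≤x+r 0≤r) ]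
  ≤⁺⇒≤[] {y = ⊤⁺}    _   _     = _ ≤⊤⁺

  ≤[0]⇒≤⁺ : ∀ {x y} → x ≤[ 0# ] y → x ≤⁺ y
  ≤[0]⇒≤⁺ {y = [ y ]} [ p ] = [ ≤-trans p (≤-reflexive (+-identityʳ y)) ]
  ≤[0]⇒≤⁺ {y = ⊤⁺}    _     = _ ≤⊤⁺

  -- Slacks add up. The total is any `t` with a proof of `r + s ≈ t`, so that a slack 0 or weighted
  -- slacks can be absorbed directly.
  +∞-mono-≤[] : ∀ {r s t x y u v} → r + s ≈ t →
                x ≤[ r ] y → u ≤[ s ] v → x +∞ u ≤[ t ] y +∞ v
  +∞-mono-≤[] {r} {s} {y = [ y ]} {v = [ v ]} r+s≈t [ p ] [ q ] = [ ≤-trans (+-mono-≤ p q)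
    (≤-reflexive (≈-trans (interchange y r v s) (+-congˡ r+s≈t))) ]
  +∞-mono-≤[] {y = [ _ ]} {v = ⊤⁺} _ _ _ = _ ≤⊤⁺
  +∞-mono-≤[] {y = ⊤⁺} _ _ _ = _ ≤⊤⁺

  +∞-monoˡ-≤[] : ∀ {r x y} z → x ≤[ r ] y → x +∞ z ≤[ r ] y +∞ z
  +∞-monoˡ-≤[] {r} z p = +∞-mono-≤[] (+-identityʳ r) p (≤⁺⇒≤[] {x = z} ≤-refl ≤⁺-refl)

  +∞-monoʳ-≤[] : ∀ {r x y} z → x ≤[ r ] y → z +∞ x ≤[ r ] z +∞ y
  +∞-monoʳ-≤[] {r} z p = +∞-mono-≤[] (+-identityˡ r) (≤⁺⇒≤[] {x = z} ≤-refl ≤⁺-refl) p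

  -- If the left difference is 0, by truncation or because `z` is `∞`, then `0# ≤ r` keeps the right
  -- side nonnegative.
  ∸∞-monoˡ-≤[] : ∀ {r x y} z → 0# ≤ r → x ≤[ r ] y → x ∸∞ z ≤[ r ] y ∸∞ z
  ∸∞-monoˡ-≤[] ⊤⁺ 0≤r _ = [ x≤x+r 0≤r ]
  ∸∞-monoˡ-≤[] {r} {[ x ]} {[ y ]} [ z ] 0≤r [ p ] = [ ⊔-lub
    (≤-trans (+-monoˡ-≤ (- z) p)
      (≤-trans (≤-reflexive (xy∙z≈xz∙y y r (- z))) (+-monoˡ-≤ r (x≤x⊔y _ _))))
    (≤-trans (x≤y⊔x _ _) (x≤x+r 0≤r)) ]
  ∸∞-monoˡ-≤[] {y = ⊤⁺} [ z ] _ _ = _ ≤⊤⁺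

  ·∞-zeroˡ : ∀ {a} x → a ≈ 0# → a ·∞ x ≤⁺ [ 0# ]
  ·∞-zeroˡ [ x ] a≈0 = [ ≤-reflexive (≈-trans (*-congʳ a≈0) (zeroˡ x)) ]
  ·∞-zeroˡ {a} ⊤⁺ a≈0 with em {a ≈ 0#}
  ... | yes _   = ≤⁺-refl
  ... | no  a≉0 = contradiction a≈0 a≉0

  ·∞-mono-≤[] : ∀ {a r x y} → 0# ≤ a → 0# ≤ r → x ≤[ r ] y → a ·∞ x ≤[ a * r ] a ·∞ y
  ·∞-mono-≤[] {a} {r} {[ x ]} {[ y ]} 0≤a _ [ p ] =
    [ ≤-trans (*-monoˡ-≤ 0≤a p) (≤-reflexive (distribˡ a y r)) ]
  ·∞-mono-≤[] {a} {r} {x} {⊤⁺} 0≤a 0≤r _ with em {a ≈ 0#}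
  ... | no  _   = _ ≤⊤⁺
  -- Here `a ·∞ ∞` is 0 by convention, so the left side has to vanish as well, even for infinite
  -- `x`.
  ... | yes a≈0 = ≤⁺⇒≤[] (*-nonNeg 0≤a 0≤r) (·∞-zeroˡ x a≈0)

  -- The weights sum to 1, so the slacks `w₁ * r` and `w₂ * r` of the summands recombine to `r`.
  weighted-mono-≤[] : ∀ {b r} {x y u v : [ b ,∞]} W → 0# ≤ r →
    value x ≤[ r ] value y → value u ≤[ r ] value v →
    value (weighted W x u) ≤[ r ] value (weighted W y v)
  weighted-mono-≤[] {r = r} W 0≤r p q =
    +∞-mono-≤[] w₁r+w₂r≈r (·∞-mono-≤[] 0≤w₁ 0≤r p) (·∞-mono-≤[] 0≤w₂ 0≤r q)
    where
    open Weights W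
    w₁r+w₂r≈r : w₁ * r + w₂ * r ≈ r
    w₁r+w₂r≈r = ≈-trans (≈-sym (distribʳ r w₁ w₂)) (≈-trans (*-congʳ w₁+w₂≈1) (*-identityˡ r))

  -- Infima and suprema up to slack.

  module _ {b : ℝ} {I : Set} where

    ⨅-lower : (f : I → [ b ,∞]) → ∀ i → ⨅ f ⊑ f i
    ⨅-lower f = proj₁ (proj₂ (infimum f))

    -- Unlike IsInf, this also covers lower bounds x that are not above b.
    ⨅-greatest : (f : I → [ b ,∞]) → ∀ {x} → (∀ i → x ≤⁺ value (f i)) → x ≤⁺ value (⨅ f)
    ⨅-greatest f {⊤⁺} lb = proj₂ (proj₂ (infimum f)) top lb
    ⨅-greatest f {[ x ]} lb with total b x
    ... | inj₁ b≤x = proj₂ (proj₂ (infimum f)) ([ x ] , [ b≤x ]) lb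
    ... | inj₂ x≤b = ≤⁺-trans [ x≤b ] (bound (⨅ f))

    -- With the slack moved to the left, `⨅ f` minus `r` is a lower bound of `g`. It may lie below
    -- `b`, which `⨅-greatest` allows.
    ⨅-mono-≤[] : ∀ {r} {f g : I → [ b ,∞]} →
                 (∀ i → value (f i) ≤[ r ] value (g i)) → value (⨅ f) ≤[ r ] value (⨅ g)
    ⨅-mono-≤[] {f = f} {g} f≤g =
      -r≤⇒≤[] (⨅-greatest g (λ i → ≤[]⇒-r≤ (≤⁺-trans (⨅-lower f i) (f≤g i))))

    -- `⨆ g` raised by `r` is an upper bound of `f`, and `0# ≤ r` keeps it in `[ b ,∞]`.
    ⨆-mono-≤[] : ∀ {r} {f g : I → [ b ,∞]} → 0# ≤ r →
                 (∀ i → value (f i) ≤[ r ] value (g i)) → value (⨆ f) ≤[ r ] value (⨆ g)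
    ⨆-mono-≤[] {r} {f} {g} 0≤r f≤g = proj₂ (proj₂ (supremum∞ f)) (⨆ g ⊹ ([ r ] , [ 0≤r ]))
      (λ i → ≤⁺-trans (f≤g i) (+∞-mono-≤ (proj₁ (proj₂ (supremum∞ g)) i) ≤⁺-refl))

-- Transformers that preserve slack.

module CalculusProperties (𝓡 : CompleteOrderedField) (em : ExcludedMiddle 0ℓ) (n : ℕ) where

  open Calculus 𝓡 em n
  open ExtendedProperties 𝓡 em

  -- A record rather than a function type, so that X and Y can be inferred.
  infix 4 _≼[_]_
  record _≼[_]_ {b} (X : Above b) (r : ℝ) (Y : Above b) : Set where
    constructor pointwise
    field at : ∀ σ → value (X σ) ≤[ r ] value (Y σ)

  open _≼[_]_

  ≼⇒≼[] : ∀ {b r} {X Y : Above b} → 0# ≤ r → X ≼ Y → X ≼[ r ] Y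
  ≼⇒≼[] 0≤r X≼Y .at σ = ≤⁺⇒≤[] 0≤r (X≼Y σ)

  -- A one-sided 1-Lipschitz condition for the supremum distance.
  NonExpansive : ∀ {b c} → (Above b → Above c) → Set
  NonExpansive Φ = ∀ {r X Y} → 0# ≤ r → X ≼[ r ] Y → Φ X ≼[ r ] Φ Y

  Monotone : ∀ {b c} → (Above b → Above c) → Set
  Monotone Φ = ∀ X Y → X ≼ Y → Φ X ≼ Φ Y

  nonExpansive⇒monotone : ∀ {b c} {Φ : Above b → Above c} → NonExpansive Φ → Monotone Φ
  nonExpansive⇒monotone ne X Y X≼Y σ = ≤[0]⇒≤⁺ (ne {X = X} {Y} ≤-refl (≼⇒≼[] ≤-refl X≼Y) .at σ)

  -- Least fixed points of monotone maps.

  module KnasterTarski {b} {Φ : Above b → Above b} (mono : Monotone Φ) where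

    Prefixed : Set
    Prefixed = Σ[ P ∈ Above b ] Φ P ≼ P

    -- `lfp` is an infimum of fixed points only, whereas induction needs prefixed points; for
    -- monotone `Φ` the two infima agree.
    least : Above b
    least σ = ⨅ {I = Prefixed} (λ (P , _) → P σ)

    least-≼ : ((P , _) : Prefixed) → least ≼ P
    least-≼ P σ = ⨅-lower _ P

    least-prefixed : Φ least ≼ least
    least-prefixed σ = ⨅-greatest _
      (λ P@(Q , ΦQ≼Q) → ≤⁺-trans (mono least Q (least-≼ P) σ) (ΦQ≼Q σ))

    least-fixed : ∀ σ → Φ least σ ≃ least σ
    least-fixed σ = ≤⁺-antisym (least-prefixed σ)
      (least-≼ (Φ least , mono (Φ least) least least-prefixed) σ)

    lfp≼least : lfp Φ ≼ least
    lfp≼least σ = ⨅-lower _ (least , least-fixed)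

    least≼lfp : least ≼ lfp Φ
    least≼lfp σ = ⨅-greatest _ (λ (P , fix) → least-≼ (P , λ τ → ≈⁺⇒≤⁺ (fix τ)) σ)
      where
      ≈⁺⇒≤⁺ : ∀ {x y} → x ≈⁺ y → x ≤⁺ y
      ≈⁺⇒≤⁺ = AddSupOrder.≤⁺-reflexive _≤_ ≤-reflexive

    lfp-≼ : ((P , _) : Prefixed) → lfp Φ ≼ P
    lfp-≼ P σ = ≤⁺-trans (lfp≼least σ) (least-≼ P σ)

    lfp-prefixed : Φ (lfp Φ) ≼ lfp Φ
    lfp-prefixed σ = ≤⁺-trans (mono (lfp Φ) least lfp≼least σ)
      (≤⁺-trans (least-prefixed σ) (least≼lfp σ))

  -- Separating connectives and atomic statements.

  ⊕-nonExpansive : ∀ f → NonExpansive (f ⊕_)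
  ⊕-nonExpansive f _ X≼Y .at (s , h) = ⨅-mono-≤[]
    (λ (h₁ , h₂ , _) → +∞-monoʳ-≤[] (value (f (s , h₁))) (X≼Y .at (s , h₂)))

  ─⊖-nonExpansive : ∀ f → NonExpansive (f ─⊖_)
  ─⊖-nonExpansive f {X = X} {Y} 0≤r X≼Y .at (s , h) = ⨆-mono-≤[]
    {f = λ (h′ , h″ , _) → X (s , h″) ⊖ f (s , h′)}
    {g = λ (h′ , h″ , _) → Y (s , h″) ⊖ f (s , h′)} 0≤r
    (λ (h′ , h″ , _) → ∸∞-monoˡ-≤[] (value (f (s , h′))) 0≤r (X≼Y .at (s , h″)))

  [/]-nonExpansive : ∀ x e → NonExpansive (_[ x / e ])
  [/]-nonExpansive x e _ X≼Y .at (s , h) = X≼Y .at (s [ x ]≔ e s , h)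

  ertᵃ-nonExpansive : ∀ A → NonExpansive (ertᵃ A)
  ertᵃ-nonExpansive (x ≔ e) 0≤r X≼Y = [/]-nonExpansive x e 0≤r X≼Y
  ertᵃ-nonExpansive (x ≔alloc e) {X = X} {Y} 0≤r X≼Y .at σ = ⨆-mono-≤[]
    {f = λ v → (block e v ─⊖ X [ x / val v ]) σ}
    {g = λ v → (block e v ─⊖ Y [ x / val v ]) σ} 0≤r (λ v →
    ─⊖-nonExpansive (block e v) 0≤r ([/]-nonExpansive x (val v) 0≤r X≼Y) .at σ)
  ertᵃ-nonExpansive (⟨ e ⟩≔ e′) 0≤r X≼Y =
    ⊕-nonExpansive (e ⟼-) 0≤r (─⊖-nonExpansive (e ⟼ e′) 0≤r X≼Y)
  ertᵃ-nonExpansive (x ≔⟨ e ⟩) 0≤r X≼Y .at σ = ⨅-mono-≤[] (λ v →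
    ⊕-nonExpansive (e ⟼ val v) 0≤r
      (─⊖-nonExpansive (e ⟼ val v) 0≤r ([/]-nonExpansive x (val v) 0≤r X≼Y)) .at σ)
  ertᵃ-nonExpansive (free e) 0≤r X≼Y = ⊕-nonExpansive (e ⟼-) 0≤r X≼Y

  +π-nonExpansive : ∀ {π} → NonExpansive (_+π {π})
  +π-nonExpansive {π} _ X≼Y .at σ = +∞-monoˡ-≤[] [ π σ ] (X≼Y .at σ)

  -π-nonExpansive : ∀ {π} → NonExpansive (_-π {π})
  -π-nonExpansive {π} _ X≼Y .at σ = +∞-monoˡ-≤[] [ - π σ ] (X≼Y .at σ)

  -- Branching, loops and the induction on programs.

  mix-mono-≼[] : ∀ {b r} {X Y U V : Above b} p → 0# ≤ r →
                 X ≼[ r ] Y → U ≼[ r ] V → mix p X U ≼[ r ] mix p Y V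
  mix-mono-≼[] {X = X} {Y} {U} {V} p 0≤r X≼Y U≼V .at σ@(s , _) =
    weighted-mono-≤[] {x = X σ} {Y σ} {U σ} {V σ} (bias (p s)) 0≤r (X≼Y .at σ) (U≼V .at σ)

  cond-mono-≼[] : ∀ {b r} {X Y U V : Above b} φ → 0# ≤ r →
                  X ≼[ r ] Y → U ≼[ r ] V → cond φ X U ≼[ r ] cond φ Y V
  cond-mono-≼[] {X = X} {Y} {U} {V} φ 0≤r X≼Y U≼V .at σ@(s , _) =
    weighted-mono-≤[] {x = X σ} {Y σ} {U σ} {V σ} (guard (φ s)) 0≤r (X≼Y .at σ) (U≼V .at σ)

  lfp-mono-≼[] : ∀ {b r} {Φ Ψ : Above b → Above b} → Monotone Φ → Monotone Ψ → 0# ≤ r →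
                 (∀ {X Y} → X ≼[ r ] Y → Φ X ≼[ r ] Ψ Y) → lfp Φ ≼[ r ] lfp Ψ
  lfp-mono-≼[] {r = r} {Φ} {Ψ} Φ-mono Ψ-mono 0≤r Φ≼Ψ .at =
    KnasterTarski.lfp-≼ {Φ = Φ} Φ-mono
    -- `lfp Ψ + r` is within slack `r` of `lfp Ψ`, so `Φ` sends it below `Ψ (lfp Ψ) + r`, hence
    -- below `lfp Ψ + r`.
    (lfp Ψ ∔ (λ _ → [ r ] , [ 0≤r ]) , λ σ → ≤⁺-trans
      (Φ≼Ψ {Y = lfp Ψ} (pointwise λ _ → ≤⁺-refl) .at σ)
      (+∞-mono-≤ (KnasterTarski.lfp-prefixed {Φ = Ψ} Ψ-mono σ) ≤⁺-refl))

  aert-nonExpansive : ∀ π C → NonExpansive (aert π C)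
  aert-nonExpansive π (tick e) _ X≼Y .at σ@(s , _) =
    +∞-monoˡ-≤[] (value (natural (e s))) (X≼Y .at σ)
  aert-nonExpansive π (atomic A) 0≤r X≼Y =
    -π-nonExpansive 0≤r (ertᵃ-nonExpansive A 0≤r (+π-nonExpansive 0≤r X≼Y))
  aert-nonExpansive π (⟪ C₁ ⟫[ p ]⟪ C₂ ⟫) 0≤r X≼Y = mix-mono-≼[] p 0≤r
    (aert-nonExpansive π C₁ 0≤r X≼Y) (aert-nonExpansive π C₂ 0≤r X≼Y)
  aert-nonExpansive π (If φ then C₁ else C₂) 0≤r X≼Y = cond-mono-≼[] φ 0≤r
    (aert-nonExpansive π C₁ 0≤r X≼Y) (aert-nonExpansive π C₂ 0≤r X≼Y)
  aert-nonExpansive π (C₁ ⨾ C₂) 0≤r X≼Y =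
    aert-nonExpansive π C₁ 0≤r (aert-nonExpansive π C₂ 0≤r X≼Y)
  aert-nonExpansive π (while φ C) {r} {X} {Y} 0≤r X≼Y =
    -- The induction hypothesis for the loop body serves twice: at slack `r` to compare the two loop
    -- functionals, and at slack 0 to make each of them monotone.
    lfp-mono-≼[] (body-monotone X) (body-monotone Y) 0≤r
      (λ U≼V → cond-mono-≼[] φ 0≤r (aert-nonExpansive π C 0≤r U≼V) X≼Y)
    where
    body-monotone : ∀ Z → Monotone (λ U → cond φ (aert π C U) Z)
    body-monotone Z = nonExpansive⇒monotone {Φ = λ U → cond φ (aert π C U) Z}
      (λ 0≤s U≼V → cond-mono-≼[] φ 0≤s (aert-nonExpansive π C 0≤s U≼V)
        (≼⇒≼[] {X = Z} {Z} 0≤s (λ _ → ≤⁺-refl)))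

  aert-∔-constant : ∀ π C (X : 𝔸 π) c → aert π C (X ∔ λ _ → c) ≼ aert π C X ∔ λ _ → c
  -- An infinite constant makes the right side `∞`.
  aert-∔-constant π C X (⊤⁺ , _) σ = ≤+∞∞ (value (aert π C X σ))
  aert-∔-constant π C X ([ r ] , [ 0≤r ]) =
    -- `X + r` is within slack `r` of `X` by reflexivity.
    aert-nonExpansive π C {Y = X} 0≤r (pointwise λ _ → ≤⁺-refl) .at

mainTheorem4 : (𝓡 : CompleteOrderedField) (em : ExcludedMiddle 0ℓ) (n : ℕ) →
    let open Calculus 𝓡 em n in
    (π : State → ℝ) → (∀ σ → 0# ≤ π σ) →
    (C : Program) (X : 𝔸 π) (c : [ 0# ,∞]) →
    aert π C (X ∔ (λ _ → c)) ≼ aert π C X ∔ (λ _ → c)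
mainTheorem4 𝓡 em n π _ = CalculusProperties.aert-∔-constant 𝓡 em n π
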